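{- For each nonnegative integer $k$, the map $\mathrm{DL}_k$ sends $\mathcal U_{2k+1}(312)$ into $\mathrm{Int}(\mathcal L_k^S)$, and $\mathrm{DL}_k:\mathcal U_{2k+1}(312)\to\mathrm{Int}(\mathcal L_k^S)$ is a bijection.
   Context: Permutations are finite words of distinct positive integers; $S_n$ is the set of permutations of $[n]=\{1,\dots,n\}$. The stack-sorting map $s$ is defined recursively: $s$ of the empty word is empty, and if $\pi=LnR$ where $n$ is the largest entry of $\pi$, then $s(\pi)=s(L)s(R)n$. The fertility of $\pi$ is the number of permutations $\sigma$ (of the same entries) with $s(\sigma)=\pi$; $\pi$ is sorted if its fertility is positive and uniquely sorted if its fertility equals $1$. A permutation $\sigma$ contains a pattern $\tau=\tau_1\cdots\tau_m$ if some subsequence of $\sigma$ has the same relative order as $\tau$; otherwise it avoids $\tau$. $\mathcal U_n(\tau^{(1)},\dots,\tau^{(r)})$ denotes the set of uniquely sorted permutations in $S_n$ avoiding all of $\tau^{(1)},\dots,\tau^{(r)}$. A descent of $\pi=\pi_1\cdots\pi_n$ is an index $i\in[n-1]$ with $\pi_i>\pi_{i+1}$; $\mathrm{Des}(\pi)$ is the set of descents. For $\pi\in S_n$, $\mathrm{rot}(\pi)=\mathrm{rev}(\pi^{ -1})$, where $\mathrm{rev}$ reverses the word and $\pi^{ -1}$ is the group inverse. A Dyck path of semilength $k$ is a word in $\{U,D\}$ with $k$ letters of each kind such that every prefix has at least as many $U$'s as $D$'s; $\mathbf D_k$ is the set of these. The Stanley lattice $\mathcal L_k^S$ is $\mathbf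 D_k$ ordered by $\Lambda\le_S\Lambda'$ iff for every $i\in\{1,\dots,2k\}$ the number of $U$'s among the first $i$ letters of $\Lambda$ is at most that among the first $i$ letters of $\Lambda'$. For a poset $P$, $\mathrm{Int}(P)$ is the set of pairs $(x,y)$ of elements of $P$ with $x\le y$. For $\pi\in\mathcal U_{2k+1}(312)$ with $n=2k+1$, define words $\Lambda=\Lambda_1\cdots\Lambda_{2k}$ and $\Lambda'=\Lambda'_1\cdots\Lambda'_{2k}$ by $\Lambda_i=D$ if $n-i\in\mathrm{Des}(\pi)$ and $\Lambda_i=U$ otherwise, and $\Lambda'_i=U$ if $i\in\mathrm{Des}(\mathrm{rot}(\pi))$ and $\Lambda'_i=D$ otherwise. Set $\mathrm{DL}_k(\pi)=(\Lambda,\Lambda')$. -}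

module Defs where

open import Data.Nat using (ℕ; zero; suc; _+_; _*_; _∸_; _≤_; _<_; _<ᵇ_; _⊔_; _≡ᵇ_)
open import Data.Nat.Properties using (_<?_)
open import Data.Bool using (Bool; true; false; if_then_else_)
open import Data.List using (List; []; _∷_; _++_; map; length; upTo; reverse; filter; take; foldr)
open import Data.List.Relation.Binary.Permutation.Propositional using (_↭_)
open import Data.List.Relation.Binary.Sublist.Propositional using (_⊆_)
open import Data.Product using (Σ; _×_; _,_; ∃)
open import Relation.Binary.PropositionalEquality using (_≡_)
open import Relation.Nullary using (¬_)

range1 : ℕ → List ℕ
range1 n = map suc (upTo n)

IsPerm : ℕ → List ℕ → Set
IsPerm n π = π ↭ range1 n

maxL : List ℕ → ℕ
maxL = foldr _⊔_ 0

splitAt : ℕ → List ℕ → List ℕ × List ℕ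
splitAt m [] = [] , []
splitAt m (x ∷ xs) with x ≡ᵇ m
... | true  = [] , xs
... | false with splitAt m xs
...   | (L , R) = (x ∷ L) , R

-- fuel-bounded version of the recursion (the fuel length π always suffices,
-- since L and R are strictly shorter than π)
sFuel : ℕ → List ℕ → List ℕ
sFuel zero    _  = []
sFuel (suc f) [] = []
sFuel (suc f) π@(_ ∷ _) with splitAt (maxL π) π
... | (L , R) = sFuel f L ++ sFuel f R ++ (maxL π ∷ [])

stackSort : List ℕ → List ℕ
stackSort π = sFuel (length π) π

UniquelySorted : ℕ → List ℕ → Set
UniquelySorted n π =
  Σ (List ℕ) λ σ → (IsPerm n σ × stackSort σ ≡ π)
                   × (∀ τ → IsPerm n τ → stackSort τ ≡ π → τ ≡ σ)

standardize : List ℕ → List ℕ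
standardize ρ = map (λ x → suc (length (filter (_<? x) ρ))) ρ

Contains : List ℕ → List ℕ → Set
Contains σ τ = Σ (List ℕ) λ ρ → (ρ ⊆ σ) × (standardize ρ ≡ standardize τ)

Avoids : List ℕ → List ℕ → Set
Avoids σ τ = ¬ Contains σ τ

p312 : List ℕ
p312 = 3 ∷ 1 ∷ 2 ∷ []

InU312 : ℕ → List ℕ → Set
InU312 n π = IsPerm n π × UniquelySorted n π × Avoids π p312

-- Descents (1-indexed): isDesc π i = true iff i ∈ Des(π)

isDesc : List ℕ → ℕ → Bool
isDesc (a ∷ b ∷ rest) 1             = b <ᵇ a
isDesc (a ∷ rest)     (suc (suc i)) = isDesc rest (suc i)
isDesc _              _             = false

-- 1-indexed position of j in π (only used when j occurs in π)
position : ℕ → List ℕ → ℕ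
position j [] = 0
position j (x ∷ xs) = if x ≡ᵇ j then 1 else suc (position j xs)

inverse : List ℕ → List ℕ
inverse π = map (λ j → position j π) (range1 (length π))

rot : List ℕ → List ℕ
rot π = reverse (inverse π)

data Step : Set where
  U D : Step

countU : List Step → ℕ
countU [] = 0
countU (U ∷ w) = suc (countU w)
countU (D ∷ w) = countU w

countD : List Step → ℕ
countD [] = 0
countD (U ∷ w) = countD w
countD (D ∷ w) = suc (countD w)

IsDyck : ℕ → List Step → Set
IsDyck k w = (countU w ≡ k) × (countD w ≡ k)
           × (∀ i → countD (take i w) ≤ countU (take i w))

_≤S_ : List Step → List Step → Set
Λ ≤S Λ′ = ∀ i → 1 ≤ i → i ≤ length Λ → countU (take i Λ) ≤ countU (take i Λ′)

InInt : ℕ → List Step × List Step → Set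
InInt k (Λ , Λ′) = IsDyck k Λ × IsDyck k Λ′ × Λ ≤S Λ′

DL : ℕ → List ℕ → List Step × List Step
DL k π =
  map (λ i → if isDesc π (n ∸ i) then D else U) (range1 (2 * k)) ,
  map (λ i → if isDesc (rot π) i then U else D) (range1 (2 * k))
  where n = suc (2 * k)

{-# OPTIONS --safe #-}
module Submission where

-- With n = 2k+1, the words Λ and Λ′ record, read backwards, the descents of π and of π⁻¹. A
-- 312-avoiding permutation is the output of a stack fed with 1, …, n; its descents are the pops
-- followed by a pop and the descents of its inverse are the pushes followed by a push, so the two
-- words reconstruct the run of the stack, and a pair of words is realised by a run exactly when no
-- pop meets an empty stack, which is the dominance Λ ≤ Λ′ (with equally many U's).
--
-- It remains to see that a 312-avoiding π is uniquely sorted iff Λ is a Dyck path. The preimages of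
-- π = A B n under s are the words σ n τ with s(σ) = A and s(τ) = B, and if A and B are nonempty then
-- Λ(π) = U Λ(B) x Λ(A) for some letter x. Hence Λ(π) never goes below 0 when π is sorted. If Λ(π)
-- also ends at 0, then x = D is its first return to 0, which determines A and B and, inductively,
-- the preimage. Conversely, in a 312-avoiding word the second entry of the last ascent exceeds all
-- earlier entries, so a nonnegative path can be decomposed in this way to build a preimage, and two
-- different ones if the path ends above 0.

open import Defs
open import Data.Bool using (Bool; true; false; if_then_else_; T)
open import Data.List using (List; []; _∷_; [_]; _++_; length; iterate; replicate; reverse; take;
  drop; map; filter; upTo; applyUpTo; applyDownFrom; initLast; _∷ʳ′_)
open import Data.List.Properties using (∷-injective; ∷-injectiveˡ; ∷-injectiveʳ; ∷ʳ-injective;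
  ++-assoc; ++-identityʳ; ++-conicalʳ; ++-cancelʳ; length-++; length-++-≤ˡ; length-++-≤ʳ;
  length-map; length-upTo; length-replicate; length-take; length-drop; length-reverse;
  map-∘; map-upTo; take-all; take++drop≡id; unfold-reverse; reverse-++; reverse-involutive;
  reverse-injective; reverse-applyUpTo)
open import Data.List.Membership.Propositional using (_∈_)
open import Data.List.Membership.Propositional.Properties using (∈-++⁻; ∈-++⁺ʳ)
open import Data.List.Relation.Binary.Permutation.Propositional
  using (_↭_; ↭-refl; ↭-sym; ↭-trans; ↭-reflexive; prep; ↭⇒↭ₛ)
open import Data.List.Relation.Binary.Permutation.Propositional.Properties
  using (∈-resp-↭; All-resp-↭; ↭-length; shift; drop-∷; ¬x∷xs↭[]; ∷↭∷ʳ)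
  renaming (++⁺ to ↭-++⁺)
import Data.List.Relation.Binary.Permutation.Setoid.Properties as PermutationProperties
open import Data.List.Relation.Binary.Pointwise using (Pointwise-≡⇒≡)
open import Data.List.Relation.Binary.Sublist.Propositional
  using (_⊆_; []; _∷_; _∷ʳ_; ⊆-refl; ⊆-reflexive; ⊆-trans; minimum; from∈; to∈)
  renaming (lookup to ∈-⊆)
open import Data.List.Relation.Binary.Sublist.Propositional.Properties using (++⁺ˡ; ++⁺ʳ; ++⁺)
open import Data.List.Relation.Binary.Sublist.Heterogeneous.Properties using (toPointwise; ∷ˡ⁻)
open import Data.List.Relation.Unary.All as All using (All; []; _∷_)
import Data.List.Relation.Unary.All.Properties as All
open import Data.List.Relation.Unary.AllPairs using (AllPairs; []; _∷_)
open import Data.List.Relation.Unary.Any using (here; there)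
open import Data.List.Relation.Unary.Unique.Propositional using (Unique)
import Data.List.Relation.Unary.Unique.Propositional.Properties as Unique
open import Data.Nat using (ℕ; zero; suc; _+_; _*_; _∸_; _⊓_; _≤_; _<_; _>_; _<ᵇ_; _≡ᵇ_;
  z≤n; s≤s; z<s; s<s)
open import Data.Nat.Properties
open import Data.Product using (Σ; ∃; ∃₂; _×_; _,_; proj₁; proj₂)
open import Data.Sum using (_⊎_; inj₁; inj₂)
open import Relation.Binary.PropositionalEquality
  using (_≡_; _≢_; refl; sym; trans; cong; cong₂; subst; setoid; module ≡-Reasoning)
open import Relation.Nullary using (¬_; yes; no; contradiction)

-- Words of comparisons between neighbouring entries

steps : (ℕ → ℕ → Step) → List ℕ → List Step
steps f (a ∷ b ∷ w) = f a b ∷ steps f (b ∷ w)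
steps f _           = []

desc : ℕ → ℕ → Step
desc a b = if b <ᵇ a then D else U

≡true⇒T : ∀ {x} → x ≡ true → T x
≡true⇒T refl = _

≡false⇒¬T : ∀ {x} → x ≡ false → ¬ T x
≡false⇒¬T refl ()

<⇒<ᵇ≡ : ∀ {a b} → a < b → (a <ᵇ b) ≡ true
<⇒<ᵇ≡ {a} {b} p with a <ᵇ b in e
... | true  = refl
... | false = contradiction (<⇒<ᵇ p) (≡false⇒¬T e)

≤⇒<ᵇ≡ : ∀ {a b} → a ≤ b → (b <ᵇ a) ≡ false
≤⇒<ᵇ≡ {a} {b} p with b <ᵇ a in e
... | false = refl
... | true  = contradiction (<ᵇ⇒< b a (≡true⇒T e)) (≤⇒≯ p)

desc-> : ∀ {a b} → b < a → desc a b ≡ D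
desc-> p rewrite <⇒<ᵇ≡ p = refl

desc-≤ : ∀ {a b} → a ≤ b → desc a b ≡ U
desc-≤ p rewrite ≤⇒<ᵇ≡ p = refl

-- Stack runs

-- In both relations s is the stack (top first), v the next input and π the remaining output;
-- the next move is a push, respectively a pop. Each push but the last contributes to α the
-- letter D if a push follows and U if a pop follows; each pop but the last contributes to β
-- the letter D if a pop follows and U if a push follows.
data Push : List ℕ → ℕ → List Step → List Step → List ℕ → Set
data Pop  : List ℕ → ℕ → List Step → List Step → List ℕ → Set

data Push where
  push-last : ∀ {s v} → Push s v [] (replicate (length s) D) (v ∷ s)
  push-push : ∀ {s v α β π} → Push (v ∷ s) (suc v) α β π → Push s v (D ∷ α) β π
  push-pop  : ∀ {s v α β π} → Pop (v ∷ s) (suc v) α β π → Push s v (U ∷ α) β π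

data Pop where
  pop-pop   : ∀ {x s v α β π} → Pop s v α β π → Pop (x ∷ s) v α (D ∷ β) (x ∷ π)
  pop-push  : ∀ {x s v α β π} → Push s v α β π → Pop (x ∷ s) v α (U ∷ β) (x ∷ π)

-- The letters of `α` and `β` prescribe every move, so the run is forced. This is the source of
-- injectivity.
push-functional : ∀ {s v α β π π′} → Push s v α β π → Push s v α β π′ → π ≡ π′
pop-functional  : ∀ {s v α β π π′} → Pop s v α β π → Pop s v α β π′ → π ≡ π′
push-functional push-last     push-last     = refl
push-functional (push-push p) (push-push q) = push-functional p q
push-functional (push-pop p)  (push-pop q)  = pop-functional p q
pop-functional (pop-pop p)  (pop-pop q)  = cong (_ ∷_) (pop-functional p q)
pop-functional (pop-push p) (pop-push q) = cong (_ ∷_) (push-functional p q)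

countU-replicate-D : ∀ n → countU (replicate n D) ≡ 0
countU-replicate-D zero    = refl
countU-replicate-D (suc n) = countU-replicate-D n

-- The U's of `α` are turns from pushing to popping, those of `β` are turns back, and the two
-- alternate; the turn after the last push is not recorded. A run that begins with a pop has one
-- turn back in excess.
push-countU : ∀ {s v α β π} → Push s v α β π → countU α ≡ countU β
pop-countU  : ∀ {s v α β π} → Pop s v α β π → suc (countU α) ≡ countU β
push-countU (push-last {s}) = sym (countU-replicate-D (length s))
push-countU (push-push p)   = push-countU p
push-countU (push-pop p)    = pop-countU p
pop-countU (pop-pop p)  = pop-countU p
pop-countU (pop-push p) = cong suc (push-countU p)

-- Each recorded turn to popping among the next `i` pushes is followed by a turn back, which happens
-- within the first `length s + i` pops, since the stack had no more entries to give by then.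
push-dominance : ∀ {s v α β π} → Push s v α β π →
  ∀ i → countU (take i α) ≤ countU (take (length s + i) β)
pop-dominance : ∀ {s v α β π} → Pop s v α β π →
  ∀ i → suc (countU (take i α)) ≤ countU (take (length s + i) β)
push-dominance p             zero    = z≤n
push-dominance push-last     (suc i) = z≤n
push-dominance {s} (push-push p) (suc i) rewrite +-suc (length s) i = push-dominance p i
push-dominance {s} (push-pop p)  (suc i) rewrite +-suc (length s) i = pop-dominance p i
pop-dominance (pop-pop p)  i = pop-dominance p i
pop-dominance (pop-push p) i = s≤s (push-dominance p i)

push-length : ∀ {s v α β π} → Push s v α β π → length β ≡ length s + length α
pop-length  : ∀ {s v α β π} → Pop s v α β π → length β ≡ length s + length α
push-length (push-last {s})   = trans (length-replicate (length s)) (sym (+-identityʳ _))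
push-length {s} (push-push p) = trans (push-length p) (sym (+-suc (length s) _))
push-length {s} (push-pop p)  = trans (pop-length p) (sym (+-suc (length s) _))
pop-length (pop-pop p)  = cong suc (pop-length p)
pop-length (pop-push p) = cong suc (push-length p)

countU-0⇒replicate-D : ∀ w → countU w ≡ 0 → w ≡ replicate (length w) D
countU-0⇒replicate-D []      _ = refl
countU-0⇒replicate-D (D ∷ w) e = cong (D ∷_) (countU-0⇒replicate-D w e)

-- The length, count and dominance conditions are those that runs satisfy by the preceding lemmas,
-- and every move hands them on to the remaining words.
push-exists : ∀ s v α β → length β ≡ length s + length α → countU α ≡ countU β →
  (∀ i → countU (take i α) ≤ countU (take (length s + i) β)) → ∃ (Push s v α β)
pop-exists : ∀ s v α β → length β ≡ length s + length α → suc (countU α) ≡ countU β →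
  (∀ i → suc (countU (take i α)) ≤ countU (take (length s + i) β)) → ∃ (Pop s v α β)
push-exists s v [] β l c d = v ∷ s , subst (λ β → Push s v [] β (v ∷ s)) (sym eq) push-last
  where
  eq : β ≡ replicate (length s) D
  eq = trans (countU-0⇒replicate-D β (sym c)) (cong (λ n → replicate n D) (trans l (+-identityʳ _)))
push-exists s v (D ∷ α) β l c d
  with π , p ← push-exists (v ∷ s) (suc v) α β (trans l (+-suc (length s) _)) c
                 (λ i → subst (λ j → countU (take i α) ≤ countU (take j β)) (+-suc (length s) i) (d (suc i)))
  = π , push-push p
push-exists s v (U ∷ α) β l c d
  with π , p ← pop-exists (v ∷ s) (suc v) α β (trans l (+-suc (length s) _)) c
                 (λ i → subst (λ j → suc (countU (take i α)) ≤ countU (take j β)) (+-suc (length s) i) (d (suc i)))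
  = π , push-pop p
-- The bound at 0 would ask for a U among no letters, so the words never prescribe a pop from an
-- empty stack.
pop-exists [] v α β l c d with () ← d 0
pop-exists (x ∷ s) v α (D ∷ β) l c d
  with π , p ← pop-exists s v α β (suc-injective l) c d = x ∷ π , pop-pop p
pop-exists (x ∷ s) v α (U ∷ β) l c d
  with π , p ← push-exists s v α β (suc-injective l) (suc-injective c) (λ i → ≤-pred (d i))
  = x ∷ π , pop-push p

-- The stack empties from the top, so its entries reach the output in stack order, whatever is
-- pushed in between.
push-stack⊆ : ∀ {s v α β π} → Push s v α β π → (v ∷ s) ⊆ π
pop-stack⊆  : ∀ {s v α β π} → Pop s v α β π → s ⊆ π
push-stack⊆ push-last     = ⊆-refl
push-stack⊆ (push-push p) = ∷ˡ⁻ (push-stack⊆ p)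
push-stack⊆ (push-pop p)  = pop-stack⊆ p
pop-stack⊆ (pop-pop p)  = refl ∷ pop-stack⊆ p
pop-stack⊆ (pop-push p) = refl ∷ ∷ˡ⁻ (push-stack⊆ p)

pop-next∈ : ∀ {s v α β π} → Pop s v α β π → v ∈ π
pop-next∈ (pop-pop p)  = there (pop-next∈ p)
pop-next∈ (pop-push p) = there (to∈ (push-stack⊆ p))

pop-top-next : ∀ {x s v α β π} → Pop (x ∷ s) v α β π → (x ∷ v ∷ []) ⊆ π
pop-top-next (pop-pop p)  = refl ∷ from∈ (pop-next∈ p)
pop-top-next (pop-push p) = refl ∷ from∈ (to∈ (push-stack⊆ p))

-- The relative order of `v` and `suc v` is kept as a two-entry sublist, which survives prepending
-- an output; it becomes a comparison of positions only in `inverseDescents-steps`.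
data InverseDescents (π : List ℕ) : ℕ → List Step → Set where
  []  : ∀ {v} → InverseDescents π v []
  _∷ᵁ_ : ∀ {v α} → (v ∷ suc v ∷ []) ⊆ π → InverseDescents π (suc v) α → InverseDescents π v (U ∷ α)
  _∷ᴰ_ : ∀ {v α} → (suc v ∷ v ∷ []) ⊆ π → InverseDescents π (suc v) α → InverseDescents π v (D ∷ α)

inverseDescents-∷ : ∀ {x π v α} → InverseDescents π v α → InverseDescents (x ∷ π) v α
inverseDescents-∷ []       = []
inverseDescents-∷ (p ∷ᵁ q) = (_ ∷ʳ p) ∷ᵁ inverseDescents-∷ q
inverseDescents-∷ (p ∷ᴰ q) = (_ ∷ʳ p) ∷ᴰ inverseDescents-∷ q

-- If the next input is pushed right on top of `v`, it leaves before `v`; if a pop follows the push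
-- of `v`, then `v` leaves before the next input arrives.
push-inverseDescents : ∀ {s v α β π} → Push s v α β π → InverseDescents π v α
pop-inverseDescents  : ∀ {s v α β π} → Pop s v α β π → InverseDescents π v α
push-inverseDescents push-last     = []
push-inverseDescents (push-push p) =
  ⊆-trans (refl ∷ refl ∷ minimum _) (push-stack⊆ p) ∷ᴰ push-inverseDescents p
push-inverseDescents (push-pop p)  = pop-top-next p ∷ᵁ pop-inverseDescents p
pop-inverseDescents (pop-pop p)  = inverseDescents-∷ (pop-inverseDescents p)
pop-inverseDescents (pop-push p) = inverseDescents-∷ (push-inverseDescents p)

Admissible : ℕ → List ℕ → Set
Admissible v s = AllPairs _>_ (v ∷ s)

admissible-push : ∀ {v s} → Admissible v s → Admissible (suc v) (v ∷ s)
admissible-push (a ∷ as) = (≤-refl ∷ All.map m<n⇒m<1+n a) ∷ a ∷ as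

admissible-pop : ∀ {v x s} → Admissible v (x ∷ s) → Admissible v s
admissible-pop ((_ ∷ a) ∷ (_ ∷ as)) = a ∷ as

-- The first output after a push of `v` is `v` or a later input. An entry popped just before that
-- push lies below `v`, so a pop followed by a push gives an ascent.
push-head : ∀ {s v α β π} → Push s v α β π → ∃₂ λ y ys → π ≡ y ∷ ys × v ≤ y
push-head (push-last {s} {v})      = v , s , refl , ≤-refl
push-head (push-push p) with y , ys , e , l ← push-head p = y , ys , e , <⇒≤ l
push-head (push-pop (pop-pop p))   = _ , _ , refl , ≤-refl
push-head (push-pop (pop-push p))  = _ , _ , refl , ≤-refl

steps-decreasing : ∀ v s → Admissible v s → steps desc (v ∷ s) ≡ replicate (length s) D
steps-decreasing v []      _ = refl
steps-decreasing v (x ∷ s) ((p ∷ _) ∷ as) = cong₂ _∷_ (desc-> p) (steps-decreasing x s as)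

push-steps : ∀ {s v α β π} → Admissible v s → Push s v α β π → steps desc π ≡ β
pop-steps  : ∀ {s v α β π} → Admissible v s → Pop s v α β π → steps desc π ≡ β
push-steps ad push-last     = steps-decreasing _ _ ad
push-steps ad (push-push p) = push-steps (admissible-push ad) p
push-steps ad (push-pop p)  = pop-steps (admissible-push ad) p
-- Either constructor of the second pop shows that its output is the new top `y`, which lies below
-- `x`.
pop-steps ad@((_ ∷ _) ∷ (y<x ∷ _) ∷ _) (pop-pop p@(pop-pop _))  =
  cong₂ _∷_ (desc-> y<x) (pop-steps (admissible-pop ad) p)
pop-steps ad@((_ ∷ _) ∷ (y<x ∷ _) ∷ _) (pop-pop p@(pop-push _)) =
  cong₂ _∷_ (desc-> y<x) (pop-steps (admissible-pop ad) p)
pop-steps ad@((x<v ∷ _) ∷ _) (pop-push p) with push-head p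
... | y , ys , refl , v≤y =
  cong₂ _∷_ (desc-≤ (≤-trans (<⇒≤ x<v) v≤y)) (push-steps (admissible-pop ad) p)

push-↭ : ∀ {s v α β π} → Push s v α β π → π ↭ s ++ iterate suc v (suc (length α))
pop-↭  : ∀ {s v α β π} → Pop s v α β π → π ↭ s ++ iterate suc v (suc (length α))
push-↭ (push-last {s} {v}) = ↭-trans (↭-reflexive (cong (v ∷_) (sym (++-identityʳ s)))) (↭-sym (shift v s []))
push-↭ {s} {v} (push-push p) = ↭-trans (push-↭ p) (↭-sym (shift v s _))
push-↭ {s} {v} (push-pop p)  = ↭-trans (pop-↭ p) (↭-sym (shift v s _))
pop-↭ (pop-pop p)  = prep _ (pop-↭ p)
pop-↭ (pop-push p) = prep _ (push-↭ p)

-- Avoidance of 312 by the output of a run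

iterate-suc-≤ : ∀ {x} v n → x ∈ iterate suc v n → v ≤ x
iterate-suc-≤ v (suc n) (here refl) = ≤-refl
iterate-suc-≤ v (suc n) (there i)   = <⇒≤ (iterate-suc-≤ (suc v) n i)

outputs : ∀ {s v n π x} → π ↭ s ++ iterate suc v n → x ∈ π → x ∈ s ⊎ v ≤ x
outputs {s} {v} {n} p i with ∈-++⁻ s (∈-resp-↭ p i)
... | inj₁ q = inj₁ q
... | inj₂ q = inj₂ (iterate-suc-≤ v n q)

AllPairs-⊆ : ∀ {R : ℕ → ℕ → Set} {a b} {w} → AllPairs R w → (a ∷ b ∷ []) ⊆ w → R a b
AllPairs-⊆ (_ ∷ as) (y ∷ʳ p)   = AllPairs-⊆ as p
AllPairs-⊆ (a ∷ _)  (refl ∷ p) = All.lookup a (to∈ p)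

-- Entries now on the stack leave in decreasing order, so the larger entry of an increasing pair
-- must be an input not read yet.
push-ascent : ∀ {s v α β π b c} → Admissible v s → Push s v α β π →
  (b ∷ c ∷ []) ⊆ π → b < c → v ≤ c
pop-ascent : ∀ {s v α β π b c} → Admissible v s → Pop s v α β π →
  (b ∷ c ∷ []) ⊆ π → b < c → v ≤ c
push-ascent ad push-last     q b<c = contradiction b<c (<-asym (AllPairs-⊆ ad q))
push-ascent ad (push-push p) q b<c = <⇒≤ (push-ascent (admissible-push ad) p q b<c)
push-ascent ad (push-pop p)  q b<c = <⇒≤ (pop-ascent (admissible-push ad) p q b<c)
pop-ascent ad (pop-pop p)  (_ ∷ʳ q) b<c = pop-ascent (admissible-pop ad) p q b<c
pop-ascent ad (pop-push p) (_ ∷ʳ q) b<c = push-ascent (admissible-pop ad) p q b<c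
pop-ascent (_ ∷ (x> ∷ _)) (pop-pop p)  (refl ∷ q) b<c with outputs (pop-↭ p) (to∈ q)
... | inj₁ i = contradiction b<c (<-asym (All.lookup x> i))
... | inj₂ l = l
pop-ascent (_ ∷ (x> ∷ _)) (pop-push p) (refl ∷ q) b<c with outputs (push-↭ p) (to∈ q)
... | inj₁ i = contradiction b<c (<-asym (All.lookup x> i))
... | inj₂ l = l

No312 : List ℕ → Set
No312 π = ∀ {a b c} → (a ∷ b ∷ c ∷ []) ⊆ π → b < c → ¬ c < a

-- Any increasing pair after the output `x` ends in an input still unread when `x` is popped, hence
-- above `x`; so `x` cannot play the 3.
push-no312 : ∀ {s v α β π} → Admissible v s → Push s v α β π → No312 π
pop-no312  : ∀ {s v α β π} → Admissible v s → Pop s v α β π → No312 π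
push-no312 ad push-last     q b<c = contradiction b<c (<-asym (AllPairs-⊆ ad (∷ˡ⁻ q)))
push-no312 ad (push-push p) = push-no312 (admissible-push ad) p
push-no312 ad (push-pop p)  = pop-no312 (admissible-push ad) p
pop-no312 ad (pop-pop p)  (_ ∷ʳ q) = pop-no312 (admissible-pop ad) p q
pop-no312 ad (pop-push p) (_ ∷ʳ q) = push-no312 (admissible-pop ad) p q
pop-no312 ad@((x<v ∷ _) ∷ _) (pop-pop p)  (refl ∷ q) b<c =
  <-asym (<-≤-trans x<v (pop-ascent (admissible-pop ad) p q b<c))
pop-no312 ad@((x<v ∷ _) ∷ _) (pop-push p) (refl ∷ q) b<c =
  <-asym (<-≤-trans x<v (push-ascent (admissible-pop ad) p q b<c))

-- Runs that output a given 312-avoiding word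

⊆-length⇒≡ : ∀ {s π : List ℕ} → s ⊆ π → length s ≡ length π → s ≡ π
⊆-length⇒≡ p e = Pointwise-≡⇒≡ (toPointwise e p)

-- No smaller entry precedes `v`, so `v` comes before all of `s`. This keeps the stack a sublist of
-- the wanted output when `v` is pushed.
∈-insert : ∀ {v s π} → All (_< v) s → s ⊆ π → v ∈ π →
  (∀ {t} → (t ∷ v ∷ []) ⊆ π → ¬ t < v) → (v ∷ s) ⊆ π
∈-insert a        (y ∷ʳ p)   (here refl) h = refl ∷ p
∈-insert a        (y ∷ʳ p)   (there i)   h = y ∷ʳ ∈-insert a p i (λ q → h (y ∷ʳ q))
∈-insert (l ∷ _)  (refl ∷ p) (here refl) h = contradiction l (<-irrefl refl)
∈-insert (l ∷ _)  (refl ∷ p) (there i)   h = contradiction l (h (refl ∷ from∈ i))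

-- With all input read there is no `Pop` state, because the pops after the last push are part of
-- `push-last`; `empties` stands for this situation.
data Moves (s : List ℕ) (v m : ℕ) (π : List ℕ) : Set where
  pushes : ∀ {α β} → Push s v α β π → Moves s v m π
  pops   : ∀ {α β} → Pop s v α β π → Moves s v m π
  empties : m ≡ 0 → π ≡ s → Moves s v m π

-- The greedy strategy: pop if the top of the stack is the output wanted next, otherwise push. The
-- proof of `s ⊆ π` is the invariant, and its first constructor decides between the two moves.
moves : ∀ m π {s v} → s ⊆ π → π ↭ s ++ iterate suc v m → Unique π → No312 π →
  All (_< v) s → Moves s v m π
moves zero π {s} {v} s⊆π π↭ u av a =
  empties refl (sym (⊆-length⇒≡ s⊆π (sym (↭-length (subst (π ↭_) (++-identityʳ s) π↭)))))
moves (suc m) [] {s} {v} [] π↭ u av a = contradiction (↭-sym π↭) ¬x∷xs↭[]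
moves (suc m) (x ∷ π) (refl ∷ p) π↭ (_ ∷ u) av (_ ∷ a)
  with moves (suc m) π p (drop-∷ π↭) u (λ q → av (_ ∷ʳ q)) a
... | pushes q = pops (pop-push q)
... | pops q   = pops (pop-pop q)
moves (suc m) (x ∷ π) {s} {v} (_ ∷ʳ p) π↭ u@(x∉ ∷ _) av a
  with moves m (x ∷ π) v∷s⊆ (↭-trans π↭ (shift v s _)) u av (≤-refl ∷ All.map m<n⇒m<1+n a)
  where
  v∷s⊆ : (v ∷ s) ⊆ (x ∷ π)
  v∷s⊆ with ∈-++⁻ s (∈-resp-↭ π↭ (here refl))
  ... | inj₁ x∈s         = contradiction refl (All.lookup x∉ (∈-⊆ p x∈s))
  ... | inj₂ (here refl) = refl ∷ p
  ... | inj₂ (there i) with ∈-resp-↭ (↭-sym π↭) (∈-++⁺ʳ s (here {xs = iterate suc (suc v) m} refl))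
  ...   | here refl = contradiction (iterate-suc-≤ (suc v) m i) (<-irrefl refl)
  -- Here `v < x`, so an entry `t < v` standing between `x` and `v` would complete the pattern 312.
  ...   | there v∈π = x ∷ʳ ∈-insert a p v∈π λ q t<v → av (refl ∷ q) t<v (iterate-suc-≤ (suc v) m i)
... | pushes q          = pushes (push-push q)
... | pops q            = pushes (push-pop q)
... | empties refl refl = pushes push-last

push-complete : ∀ m π → π ↭ iterate suc 1 (suc m) → Unique π → No312 π →
  ∃₂ λ α β → Push [] 1 α β π
push-complete m π π↭ u av with moves (suc m) π (minimum π) π↭ u av []
... | pushes p = _ , _ , p

-- Ballot paths

data Path : ℕ → List Step → ℕ → Set where
  []   : ∀ {i} → Path i [] i
  up   : ∀ {i j w} → Path (suc i) w j → Path i (U ∷ w) j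
  down : ∀ {i j w} → Path i w j → Path (suc i) (D ∷ w) j

path-++ : ∀ {i j k u v} → Path i u j → Path j v k → Path i (u ++ v) k
path-++ []       q = q
path-++ (up p)   q = up (path-++ p q)
path-++ (down p) q = down (path-++ p q)

path-raise : ∀ {i j w} → Path i w j → Path (suc i) w (suc j)
path-raise []       = []
path-raise (up p)   = up (path-raise p)
path-raise (down p) = down (path-raise p)

path-raise-by : ∀ {i j w} h → Path i w j → Path (i + h) w (j + h)
path-raise-by h []       = []
path-raise-by h (up p)   = up (path-raise-by h p)
path-raise-by h (down p) = down (path-raise-by h p)

path-functional : ∀ {i j k w} → Path i w j → Path i w k → j ≡ k
path-functional []       []       = refl
path-functional (up p)   (up q)   = path-functional p q
path-functional (down p) (down q) = path-functional p q

-- A path from height `suc i` either stays above 0, and can be lowered by one, or is cut at the D on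
-- which it first reaches 0; the part before the cut is lowered too.
data FirstReturn (i : ℕ) (w : List Step) (j : ℕ) : Set where
  never : ∀ {j′} → j ≡ suc j′ → Path i w j′ → FirstReturn i w j
  after : ∀ w₁ w₂ → w ≡ w₁ ++ D ∷ w₂ → Path i w₁ 0 → Path 0 w₂ j → FirstReturn i w j

first-return : ∀ {i j w} → Path (suc i) w j → FirstReturn i w j
first-return [] = never refl []
first-return (up p) with first-return p
... | never e q              = never e (up q)
... | after w₁ w₂ refl q₁ q₂ = after (U ∷ w₁) w₂ refl (up q₁) q₂
first-return {zero}  (down p) = after [] _ refl [] p
first-return {suc i} (down p) with first-return p
... | never e q              = never e (down q)
... | after w₁ w₂ refl q₁ q₂ = after (D ∷ w₁) w₂ refl (down q₁) q₂

-- Neither prefix can properly extend the other: the D after the shorter one starts at height 0 and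
-- would take the longer one below it.
first-return-unique : ∀ {i u u′ v v′} → Path i u 0 → Path i u′ 0 →
  u ++ D ∷ v ≡ u′ ++ D ∷ v′ → u ≡ u′
first-return-unique []       []       e = refl
first-return-unique (up p)   (up q)   e = cong (U ∷_) (first-return-unique p q (∷-injectiveʳ e))
first-return-unique (down p) (down q) e = cong (D ∷_) (first-return-unique p q (∷-injectiveʳ e))

path-counts : ∀ {h j w} → Path h w j → h + countU w ≡ j + countD w
path-counts [] = refl
path-counts {h} (up p) = trans (+-suc h _) (path-counts p)
path-counts {j = j} (down p) = trans (cong suc (path-counts p)) (sym (+-suc j _))

path-prefix : ∀ {h j w} → Path h w j → ∀ i → countD (take i w) ≤ h + countU (take i w)
path-prefix p        zero    = z≤n
path-prefix []       (suc i) = z≤n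
path-prefix {h} (up p)   (suc i) = ≤-trans (path-prefix p i) (≤-reflexive (sym (+-suc h _)))
path-prefix (down p) (suc i) = s≤s (path-prefix p i)

prefix-path : ∀ h j w → h + countU w ≡ j + countD w →
  (∀ i → countD (take i w) ≤ h + countU (take i w)) → Path h w j
prefix-path h j [] e d = subst (Path h []) (+-cancelʳ-≡ 0 h j e) []
prefix-path h j (U ∷ w) e d =
  up (prefix-path (suc h) j w (trans (sym (+-suc h _)) e)
       (λ i → ≤-trans (d (suc i)) (≤-reflexive (+-suc h _))))
prefix-path zero j (D ∷ w) e d with () ← d 1
prefix-path (suc h) j (D ∷ w) e d =
  down (prefix-path h j w (suc-injective (trans e (+-suc j _))) (λ i → ≤-pred (d (suc i))))

-- Descent paths of words and of their factors

descentPath : List ℕ → List Step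
descentPath w = reverse (steps desc w)

steps-++ : ∀ f a u b v → ∃ λ x →
  steps f ((a ∷ u) ++ b ∷ v) ≡ steps f (a ∷ u) ++ x ∷ steps f (b ∷ v)
steps-++ f a []      b v = f a b , refl
steps-++ f a (c ∷ u) b v with x , e ← steps-++ f c u b v = x , cong (f a c ∷_) e

steps-∷ʳ : ∀ f u a b → steps f ((u ++ [ a ]) ++ [ b ]) ≡ steps f (u ++ [ a ]) ++ [ f a b ]
steps-∷ʳ f []          a b = refl
steps-∷ʳ f (c ∷ [])    a b = refl
steps-∷ʳ f (c ∷ d ∷ u) a b = cong (f c d ∷_) (steps-∷ʳ f (d ∷ u) a b)

steps-++⁻ : ∀ f w u {x v} → steps f w ≡ u ++ x ∷ v → ∃ λ a → ∃₂ λ A B →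
  w ≡ (a ∷ A) ++ B × steps f (a ∷ A) ≡ u × steps f B ≡ v
steps-++⁻ f []          []      ()
steps-++⁻ f []          (_ ∷ _) ()
steps-++⁻ f (_ ∷ [])    []      ()
steps-++⁻ f (_ ∷ [])    (_ ∷ _) ()
steps-++⁻ f (a ∷ b ∷ w) []      refl = a , [] , b ∷ w , refl , refl , refl
steps-++⁻ f (a ∷ b ∷ w) (y ∷ u) e with ∷-injective e
... | refl , e′ with steps-++⁻ f (b ∷ w) u e′
...   | .b , A , B , refl , refl , refl = a , b ∷ A , B , refl , refl , refl

length-steps : ∀ f a w → length (steps f (a ∷ w)) ≡ length w
length-steps f a []      = refl
length-steps f a (b ∷ w) = cong suc (length-steps f b w)

descentPath-++ : ∀ a u b v → ∃ λ x →
  descentPath ((a ∷ u) ++ b ∷ v) ≡ descentPath (b ∷ v) ++ x ∷ descentPath (a ∷ u)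
descentPath-++ a u b v with x , e ← steps-++ desc a u b v = x , (begin
  reverse (steps desc ((a ∷ u) ++ b ∷ v))       ≡⟨ cong reverse e ⟩
  reverse (p ++ x ∷ q)                          ≡⟨ reverse-++ p (x ∷ q) ⟩
  reverse (x ∷ q) ++ reverse p                  ≡⟨ cong (_++ reverse p) (unfold-reverse x q) ⟩
  (reverse q ++ [ x ]) ++ reverse p             ≡⟨ ++-assoc (reverse q) [ x ] (reverse p) ⟩
  reverse q ++ x ∷ reverse p                    ∎)
  where
  open ≡-Reasoning
  p = steps desc (a ∷ u)
  q = steps desc (b ∷ v)

descentPath-∷ʳ : ∀ u a b → descentPath ((u ++ [ a ]) ++ [ b ]) ≡ desc a b ∷ descentPath (u ++ [ a ])
descentPath-∷ʳ u a b =
  trans (cong reverse (steps-∷ʳ desc u a b)) (reverse-++ (steps desc (u ++ [ a ])) [ desc a b ])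

steps-∷ʳ-max : ∀ {n} a u → All (_≤ n) (a ∷ u) →
  steps desc ((a ∷ u) ++ [ n ]) ≡ steps desc (a ∷ u) ++ [ U ]
steps-∷ʳ-max a []      (l ∷ []) = cong [_] (desc-≤ l)
steps-∷ʳ-max a (b ∷ u) (_ ∷ h)  = cong (desc a b ∷_) (steps-∷ʳ-max b u h)

descentPath-∷ʳ-max : ∀ {n} a u → All (_≤ n) (a ∷ u) →
  descentPath ((a ∷ u) ++ [ n ]) ≡ U ∷ descentPath (a ∷ u)
descentPath-∷ʳ-max a u h =
  trans (cong reverse (steps-∷ʳ-max a u h)) (reverse-++ (steps desc (a ∷ u)) [ U ])

length-descentPath : ∀ a w → length (descentPath (a ∷ w)) ≡ length w
length-descentPath a w = trans (length-reverse (steps desc (a ∷ w))) (length-steps desc a w)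

-- The stack-sorting map

-- Ties are allowed on the right of n because Defs.splitAt splits at the first maximum; this makes
-- the relation the graph of stackSort on all words.
infix 4 _↝_

data _↝_ : List ℕ → List ℕ → Set where
  []   : [] ↝ []
  node : ∀ {L R A B n} → L ↝ A → R ↝ B → All (_< n) L → All (_≤ n) R →
         L ++ n ∷ R ↝ A ++ B ++ [ n ]

↝⇒↭ : ∀ {σ w} → σ ↝ w → σ ↭ w
↝⇒↭ [] = ↭-refl
↝⇒↭ (node {R = R} {n = n} p q _ _) = ↭-++⁺ (↝⇒↭ p) (↭-trans (∷↭∷ʳ n R) (↭-++⁺ (↝⇒↭ q) ↭-refl))

-- If one left part were longer, it would contain the other maximum, which would then be both
-- smaller and at least as large as its own.
decomposition-unique : ∀ L {n R} L′ {n′ R′} → L ++ n ∷ R ≡ L′ ++ n′ ∷ R′ →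
  All (_< n) L → All (_≤ n) R → All (_< n′) L′ → All (_≤ n′) R′ →
  L ≡ L′ × n ≡ n′ × R ≡ R′
decomposition-unique [] [] refl _ _ _ _ = refl , refl , refl
decomposition-unique [] (l ∷ L′) refl _ r (l< ∷ _) _ =
  contradiction (All.head (All.++⁻ʳ L′ r)) (<⇒≱ l<)
decomposition-unique (l ∷ L) [] refl (l< ∷ _) _ _ r =
  contradiction (All.head (All.++⁻ʳ L r)) (<⇒≱ l<)
decomposition-unique (l ∷ L) (l′ ∷ L′) e (_ ∷ a) b (_ ∷ c) d with ∷-injective e
... | refl , e′ with decomposition-unique L L′ e′ a b c d
...   | refl , e₂ , e₃ = refl , e₂ , e₃

↝-functional : ∀ {σ τ w x} → σ ↝ w → τ ↝ x → σ ≡ τ → w ≡ x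
↝-functional [] [] _ = refl
↝-functional [] (node {L = []} _ _ _ _) ()
↝-functional [] (node {L = _ ∷ _} _ _ _ _) ()
↝-functional (node {L = []} _ _ _ _) [] ()
↝-functional (node {L = _ ∷ _} _ _ _ _) [] ()
↝-functional (node {L} p q a b) (node {L′} p′ q′ c d) e
  with decomposition-unique L L′ e a b c d
... | refl , refl , refl with ↝-functional p p′ refl | ↝-functional q q′ refl
...   | refl | refl = refl

maxL∈ : ∀ x xs → maxL (x ∷ xs) ∈ x ∷ xs
maxL∈ x []       = here (⊔-identityʳ x)
maxL∈ x (y ∷ xs) with ⊔-sel x (maxL (y ∷ xs))
... | inj₁ e = here e
... | inj₂ e rewrite e = there (maxL∈ y xs)

maxL-≤ : ∀ xs → All (_≤ maxL xs) xs
maxL-≤ []       = []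
maxL-≤ (x ∷ xs) = m≤m⊔n x _ ∷ All.map (λ l → ≤-trans l (m≤n⊔m x _)) (maxL-≤ xs)

splitAt-∈ : ∀ {m xs} → m ∈ xs →
  xs ≡ proj₁ (splitAt m xs) ++ m ∷ proj₂ (splitAt m xs) × All (_≢ m) (proj₁ (splitAt m xs))
splitAt-∈ {m} {x ∷ xs} i with x ≡ᵇ m in e
... | true = cong (_∷ xs) (≡ᵇ⇒≡ x m (≡true⇒T e)) , []
splitAt-∈ {m} {x ∷ xs} (here refl) | false = contradiction (≡⇒≡ᵇ x x refl) (≡false⇒¬T e)
splitAt-∈ {m} {x ∷ xs} (there i)   | false with splitAt m xs | splitAt-∈ i
... | L , R | refl , h = refl , (λ { refl → ≡false⇒¬T e (≡⇒≡ᵇ x x refl) }) ∷ h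

-- The two sides of the maximum have total length at most `f`, so the fuel never runs out.
sFuel-↝ : ∀ f π → length π ≤ f → π ↝ sFuel f π
sFuel-↝ zero    []       _ = []
sFuel-↝ (suc f) []       _ = []
sFuel-↝ (suc f) (x ∷ xs) l
  with splitAt (maxL (x ∷ xs)) (x ∷ xs) | splitAt-∈ (maxL∈ x xs)
... | L , R | e , L≢ = subst (_↝ sFuel f L ++ sFuel f R ++ [ m ]) (sym e)
      (node (sFuel-↝ f L (≤-trans (m≤m+n _ _) len)) (sFuel-↝ f R (≤-trans (m≤n+m _ _) len))
            (All.zipWith (λ (l , ne) → ≤∧≢⇒< l ne) (All.++⁻ˡ L all≤ , L≢))
            (All.tail (All.++⁻ʳ L all≤)))
  where
  m = maxL (x ∷ xs)
  all≤ : All (_≤ m) (L ++ m ∷ R)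
  all≤ = subst (All (_≤ m)) e (maxL-≤ (x ∷ xs))
  len : length L + length R ≤ f
  len = ≤-pred (subst (_≤ suc f) (trans (cong length e) (trans (length-++ L) (+-suc _ _))) l)

stackSort-↝ : ∀ π → π ↝ stackSort π
stackSort-↝ π = sFuel-↝ (length π) π ≤-refl

↝⇒stackSort : ∀ {σ w} → σ ↝ w → stackSort σ ≡ w
↝⇒stackSort {σ} p = ↝-functional (stackSort-↝ σ) p refl

-- Paths of sorted words and uniqueness of preimages

All-↝ : ∀ {P : ℕ → Set} {σ w} → σ ↝ w → All P σ → All P w
All-↝ p = All-resp-↭ (↝⇒↭ p)

-- The initial U lifts the path of `B` by one, so even a junction letter D leaves a height of at
-- least 0 for the path of `A` to start from.
sorted-path : ∀ {σ w} → σ ↝ w → ∃ (Path 0 (descentPath w))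
sorted-path [] = 0 , []
sorted-path (node {A = []} {[]} p q a b) = 0 , []
sorted-path (node {A = []} {x ∷ B} {n} p q a b) with j , r ← sorted-path q
  rewrite descentPath-∷ʳ-max {n} x B (All-↝ q b) = suc j , up (path-raise r)
sorted-path (node {A = x ∷ A} {[]} {n} p q a b) with j , r ← sorted-path p
  rewrite descentPath-∷ʳ-max {n} x A (All.map <⇒≤ (All-↝ p a)) = suc j , up (path-raise r)
sorted-path (node {A = x ∷ A} {y ∷ B} {n} p q a b)
  with i , r ← sorted-path p | j , s ← sorted-path q
     | z , e ← descentPath-++ x A y (B ++ [ n ])
  rewrite e | descentPath-∷ʳ-max {n} y B (All-↝ q b)
  with z
... | U = _ , up (path-++ (path-raise s) (up (path-raise-by (suc (suc j)) r)))
... | D = _ , up (path-++ (path-raise s) (down (path-raise-by j r)))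

data DyckNode : List ℕ → List ℕ → List Step → Set where
  leaf : DyckNode [] [] []
  fork : ∀ {A y B} → Path 0 (descentPath (y ∷ B)) 0 → Path 0 (descentPath A) 0 →
         DyckNode A (y ∷ B) (U ∷ descentPath (y ∷ B) ++ D ∷ descentPath A)

-- If exactly one factor is empty, the path is a U and a lifted path, so it ends above 0. If neither
-- is, a junction U gives the end height `i + suc (suc j)`; a junction D gives `i + j`, which forces
-- both factors to end at 0.
dyck-node : ∀ {L R A B n} → L ↝ A → R ↝ B → All (_< n) L → All (_≤ n) R →
  Path 0 (descentPath (A ++ B ++ [ n ])) 0 → DyckNode A B (descentPath (A ++ B ++ [ n ]))
dyck-node {A = []} {[]} p q a b d = leaf
dyck-node {A = []} {x ∷ B} {n} p q a b d with j , r ← sorted-path q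
  rewrite descentPath-∷ʳ-max {n} x B (All-↝ q b)
  with () ← path-functional d (up (path-raise r))
dyck-node {A = x ∷ A} {[]} {n} p q a b d with j , r ← sorted-path p
  rewrite descentPath-∷ʳ-max {n} x A (All.map <⇒≤ (All-↝ p a))
  with () ← path-functional d (up (path-raise r))
dyck-node {A = x ∷ A} {y ∷ B} {n} p q a b d
  with i , r ← sorted-path p | j , s ← sorted-path q
     | z , e ← descentPath-++ x A y (B ++ [ n ])
  rewrite e | descentPath-∷ʳ-max {n} y B (All-↝ q b)
  with z
... | U with path-functional d (up (path-++ (path-raise s) (up (path-raise-by (suc (suc j)) r))))
...   | e′ = contradiction (trans e′ (+-suc i (suc j))) λ ()
dyck-node {A = x ∷ A} {y ∷ B} {n} p q a b d | D
  with path-functional d (up (path-++ (path-raise s) (down (path-raise-by j r))))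
... | e′ with m+n≡0⇒m≡0 i (sym e′) | m+n≡0⇒n≡0 i (sym e′)
...   | refl | refl = fork s r

-- The path of `B` fills the stretch between the initial U and the first return to 0, so the whole
-- path fixes the length of `B`.
dyckNode-length : ∀ {A B A′ B′ w w′} → DyckNode A B w → DyckNode A′ B′ w′ → w ≡ w′ →
  length B ≡ length B′
dyckNode-length leaf leaf _ = refl
dyckNode-length (fork {y = y} {B} p _) (fork {y = y′} {B′} p′ _) e = cong suc (begin
  length B                        ≡⟨ length-descentPath y B ⟨
  length (descentPath (y ∷ B))    ≡⟨ cong length (first-return-unique p p′ (∷-injectiveʳ e)) ⟩
  length (descentPath (y′ ∷ B′))  ≡⟨ length-descentPath y′ B′ ⟩
  length B′                       ∎)
  where open ≡-Reasoning

dyckNode-paths : ∀ {A B w} → DyckNode A B w →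
  Path 0 (descentPath A) 0 × Path 0 (descentPath B) 0
dyckNode-paths leaf       = [] , []
dyckNode-paths (fork p q) = q , p

++-injective-length : ∀ (A A′ : List ℕ) {B B′} → A ++ B ≡ A′ ++ B′ → length B ≡ length B′ →
  A ≡ A′ × B ≡ B′
++-injective-length []      []       e    l = refl , e
++-injective-length []      (x ∷ A′) refl l =
  contradiction (trans (sym l) (cong suc (length-++ A′))) (m≢1+n+m _)
++-injective-length (x ∷ A) []       refl l =
  contradiction (trans l (cong suc (length-++ A))) (m≢1+n+m _)
++-injective-length (x ∷ A) (y ∷ A′) e    l with ∷-injective e
... | refl , e′ with ++-injective-length A A′ e′ l
...   | refl , e″ = refl , e″

-- The last entry is the root and `dyckNode-length` fixes where `A` ends. Both factors have paths
-- ending at 0 again, so induction applies.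
dyck-preimage-unique : ∀ {σ τ w x} → σ ↝ w → τ ↝ x → w ≡ x → Path 0 (descentPath w) 0 → σ ≡ τ
dyck-preimage-unique [] [] _ _ = refl
dyck-preimage-unique [] (node {A = A} {B} _ _ _ _) e _
  with () ← ++-conicalʳ B _ (++-conicalʳ A _ (sym e))
dyck-preimage-unique (node {A = A} {B} _ _ _ _) [] e _
  with () ← ++-conicalʳ B _ (++-conicalʳ A _ e)
dyck-preimage-unique (node {A = A} {B} {n} p q a b) (node {A = A′} {B′} {n′} p′ q′ a′ b′) e d
  with dn  ← dyck-node p q a b d
     | dn′ ← dyck-node p′ q′ a′ b′ (subst (λ w → Path 0 (descentPath w) 0) e d)
  with e₁ , refl ← ∷ʳ-injective (A ++ B) (A′ ++ B′)
                     (trans (++-assoc A B _) (trans e (sym (++-assoc A′ B′ _))))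
  with refl , refl ← ++-injective-length A A′ e₁ (dyckNode-length dn dn′ (cong descentPath e))
  with dA , dB ← dyckNode-paths dn
  = cong₂ (λ L R → L ++ n ∷ R) (dyck-preimage-unique p p′ refl dA)
                               (dyck-preimage-unique q q′ refl dB)

-- All that the construction of preimages needs of 312-avoidance and distinctness, in a form that
-- passes to factors.
AscentTopsDominate : List ℕ → Set
AscentTopsDominate w = ∀ u b c → (u ++ b ∷ c ∷ []) ⊆ w → b ≤ c → All (_< c) (u ++ [ b ])

-- Construction of preimages from paths

descentPath-++⁻ : ∀ w u {x v} → descentPath w ≡ u ++ x ∷ v → ∃ λ a → ∃₂ λ A B →
  w ≡ (a ∷ A) ++ B × descentPath (a ∷ A) ≡ v × descentPath B ≡ u
descentPath-++⁻ w u {x} {v} e with steps-++⁻ desc w (reverse v) (begin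
    steps desc w                      ≡⟨ reverse-involutive (steps desc w) ⟨
    reverse (reverse (steps desc w))  ≡⟨ cong reverse e ⟩
    reverse (u ++ x ∷ v)              ≡⟨ reverse-++ u (x ∷ v) ⟩
    reverse (x ∷ v) ++ reverse u      ≡⟨ cong (_++ reverse u) (unfold-reverse x v) ⟩
    (reverse v ++ [ x ]) ++ reverse u ≡⟨ ++-assoc (reverse v) [ x ] (reverse u) ⟩
    reverse v ++ x ∷ reverse u        ∎)
  where open ≡-Reasoning
... | a , A , B , e₁ , e₂ , e₃ =
  a , A , B , e₁ , trans (cong reverse e₂) (reverse-involutive v) ,
                   trans (cong reverse e₃) (reverse-involutive u)

-- The last two cases tell whether the path, after its initial U, returns to 0. If so, the first
-- return separates the path of `B` from that of `A`.
data Decomposition : List ℕ → ℕ → Set where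
  empty   : Decomposition [] 0
  single  : ∀ {n} → Decomposition [ n ] 0
  stays   : ∀ {a w n j} → All (_< n) (a ∷ w) → Path 0 (descentPath (a ∷ w)) j →
            Decomposition ((a ∷ w) ++ [ n ]) (suc j)
  returns : ∀ {A B n j} → All (_< n) A → All (_< n) B →
            Path 0 (descentPath A) j → Path 0 (descentPath B) 0 →
            Decomposition (A ++ B ++ [ n ]) j

decompose-∷ʳ : ∀ a w n {j} → All (_< n) (a ∷ w) → Path 1 (descentPath (a ∷ w)) j →
  Decomposition ((a ∷ w) ++ [ n ]) j
decompose-∷ʳ a w n {j} all< p with first-return p
... | never refl q = stays all< q
... | after w₁ w₂ e q₁ q₂ with descentPath-++⁻ (a ∷ w) w₁ e
...   | x , A , B , refl , refl , refl =
  subst (λ v → Decomposition v j) (sym (++-assoc (a ∷ A) B [ n ]))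
    (returns {a ∷ A} (All.++⁻ˡ (a ∷ A) all<) (All.++⁻ʳ (a ∷ A) all<) q₂ q₁)

path-desc : ∀ {a b w j} → Path 0 (desc a b ∷ w) j → a ≤ b × Path 1 w j
path-desc {a} {b} p with a ≤? b
... | no a≰b rewrite desc-> (≰⇒> a≰b) with () ← p
... | yes a≤b rewrite desc-≤ a≤b with up q ← p = a≤b , q

-- A path from 0 begins with U, so the last two entries do not descend, and `AscentTopsDominate`
-- makes the last entry the strict maximum.
decompose : ∀ w {j} → AscentTopsDominate w → Path 0 (descentPath w) j → Decomposition w j
decompose w h p with initLast w
decompose w h [] | [] = empty
... | v ∷ʳ′ n with initLast v
decompose w h [] | _ ∷ʳ′ n | [] = single
... | u ∷ʳ′ b = go u (h u b n (⊆-reflexive (sym (++-assoc u [ b ] [ n ]))) (proj₁ q)) (proj₂ q)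
  where
  q = path-desc (subst (λ w → Path 0 w _) (descentPath-∷ʳ u b n) p)
  go : ∀ u {j} → All (_< n) (u ++ [ b ]) → Path 1 (descentPath (u ++ [ b ])) j →
    Decomposition ((u ++ [ b ]) ++ [ n ]) j
  go []      = decompose-∷ʳ b [] n
  go (a ∷ u) = decompose-∷ʳ a (u ++ [ b ]) n

dominate-⊆ : ∀ {v w} → v ⊆ w → AscentTopsDominate w → AscentTopsDominate v
dominate-⊆ i h u b c p = h u b c (⊆-trans p i)

<⇒≤-All : ∀ {n} {w : List ℕ} → All (_< n) w → All (_≤ n) w
<⇒≤-All = All.map <⇒≤

All-↝⁻ : ∀ {P : ℕ → Set} {σ w} → σ ↝ w → All P w → All P σ
All-↝⁻ p = All-resp-↭ (↭-sym (↝⇒↭ p))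

length-init : ∀ {n k} (w : List ℕ) → length (w ++ [ n ]) < suc k → length w < k
length-init w l = ≤-pred (subst (_< _) (trans (length-++ w) (+-comm _ 1)) l)

-- The bound `k` is the measure of the recursion, as the factors are not structurally smaller. When
-- the path stays above 0, the maximum is put in front of a preimage of the rest.
preimage : ∀ k w {j} → length w < k → AscentTopsDominate w → Path 0 (descentPath w) j →
  ∃ (_↝ w)
preimage k w l h p with decompose w h p
preimage (suc k) _ l h p | empty = [] , []
preimage (suc k) _ l h p | single {n} = [ n ] , node [] [] [] []
preimage (suc k) _ l h p | stays {a} {w} {n} w< q
  with σ , r ← preimage k (a ∷ w) (length-init (a ∷ w) l) (dominate-⊆ (++⁺ʳ _ ⊆-refl) h) q
  = n ∷ σ , node [] r [] (<⇒≤-All (All-↝⁻ r w<))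
preimage (suc k) _ l h p | returns {A} {B} {n} A< B< q₁ q₂
  with l′ ← length-init (A ++ B) (subst (λ w → length w < _) (sym (++-assoc A B [ n ])) l)
  with σ , r ← preimage k A (≤-<-trans (length-++-≤ˡ A) l′) (dominate-⊆ (++⁺ʳ _ ⊆-refl) h) q₁
     | τ , s ← preimage k B (≤-<-trans (length-++-≤ʳ B {A}) l′)
                 (dominate-⊆ (++⁺ˡ A (++⁺ʳ _ ⊆-refl)) h) q₂
  = σ ++ n ∷ τ , node r s (All-↝⁻ r A<) (<⇒≤-All (All-↝⁻ s B<))

TwoPreimages : List ℕ → Set
TwoPreimages w = ∃₂ λ σ τ → σ ↝ w × τ ↝ w × σ ≢ τ

-- When the path stays above 0, the maximum may stand in front of a preimage of the rest or behind
-- it. When the path returns, the excess height is that of `A`, and two preimages of `A` give two of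
-- the whole.
two-preimages : ∀ k w {j} → length w < k → AscentTopsDominate w →
  Path 0 (descentPath w) (suc j) → TwoPreimages w
two-preimages k w {j} l h p = go k w l h p refl
  where
  distinct : ∀ {σ n} → length σ ≢ 0 → All (_< n) σ → n ∷ σ ≢ σ ++ [ n ]
  distinct {[]}    ne _ _       = ne refl
  distinct {x ∷ σ} ne (x< ∷ _) e = <⇒≢ x< (sym (∷-injectiveˡ e))
  go : ∀ k w {i} → length w < k → AscentTopsDominate w → Path 0 (descentPath w) i →
    i ≡ suc j → TwoPreimages w
  go k w l h p e with decompose w h p
  go (suc k) _ l h p e | stays {a} {w} {n} w< q
    with σ , r ← preimage k (a ∷ w) (length-init (a ∷ w) l) (dominate-⊆ (++⁺ʳ _ ⊆-refl) h) q
    = n ∷ σ , σ ++ [ n ] , node [] r [] (<⇒≤-All (All-↝⁻ r w<)) ,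
      node r [] (All-↝⁻ r w<) [] ,
      distinct (λ e → contradiction (trans (sym (↭-length (↝⇒↭ r))) e) λ ()) (All-↝⁻ r w<)
  go (suc k) _ l h p refl | returns {A} {B} {n} A< B< q₁ q₂
    with l′ ← length-init (A ++ B) (subst (λ w → length w < _) (sym (++-assoc A B [ n ])) l)
    with σ , σ′ , r , r′ , ne ← go k A (≤-<-trans (length-++-≤ˡ A) l′) (dominate-⊆ (++⁺ʳ _ ⊆-refl) h) q₁ refl
       | τ , s ← preimage k B (≤-<-trans (length-++-≤ʳ B {A}) l′)
                   (dominate-⊆ (++⁺ˡ A (++⁺ʳ _ ⊆-refl)) h) q₂
    = σ ++ n ∷ τ , σ′ ++ n ∷ τ , node r s (All-↝⁻ r A<) (<⇒≤-All (All-↝⁻ s B<)) ,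
      node r′ s (All-↝⁻ r′ A<) (<⇒≤-All (All-↝⁻ s B<)) , λ e → ne (++-cancelʳ _ _ _ e)

-- The words of DL

range1-iterate : ∀ n → range1 n ≡ iterate suc 1 n
range1-iterate n = trans (map-upTo suc n) (go suc 1 n λ i → sym (+-comm i 1))
  where
  go : ∀ f v n → (∀ i → f i ≡ i + v) → applyUpTo f n ≡ iterate suc v n
  go f v zero    h = refl
  go f v (suc n) h = cong₂ _∷_ (h 0) (go (λ i → f (suc i)) (suc v) n λ i → trans (h (suc i)) (sym (+-suc i v)))

length-range1 : ∀ n → length (range1 n) ≡ n
length-range1 n = trans (length-map suc (upTo n)) (length-upTo n)

perm-length : ∀ {n π} → IsPerm n π → length π ≡ n
perm-length {n} p = trans (↭-length p) (length-range1 n)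

perm-unique : ∀ {n π} → IsPerm n π → Unique π
perm-unique {n} p =
  PermutationProperties.Unique-resp-↭ (setoid ℕ) (↭⇒↭ₛ (↭-sym p)) (Unique.map⁺ suc-injective (Unique.upTo⁺ n))

-- Occurrences of the pattern 312

standardize-312 : ∀ {a b c} → b < c → c < a → standardize (a ∷ b ∷ c ∷ []) ≡ p312
standardize-312 {a} {b} {c} b<c c<a
  rewrite ≤⇒<ᵇ≡ (≤-refl {a}) | <⇒<ᵇ≡ (<-trans b<c c<a) | <⇒<ᵇ≡ c<a
        | ≤⇒<ᵇ≡ (<⇒≤ (<-trans b<c c<a)) | ≤⇒<ᵇ≡ (≤-refl {b}) | ≤⇒<ᵇ≡ (<⇒≤ b<c)
        | ≤⇒<ᵇ≡ (<⇒≤ c<a) | <⇒<ᵇ≡ b<c | ≤⇒<ᵇ≡ (≤-refl {c}) = refl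

avoids⇒no312 : ∀ {π} → Avoids π p312 → No312 π
avoids⇒no312 av q b<c c<a = av (_ , q , standardize-312 b<c c<a)

-- Rank 3 puts both other entries below `a`; then rank 2 leaves only `b` to lie below `c`.
standardize⁻-312 : ∀ a b c → standardize (a ∷ b ∷ c ∷ []) ≡ p312 → b < c × c < a
standardize⁻-312 a b c e = b<c (∷-injectiveˡ (∷-injectiveʳ (∷-injectiveʳ e))) , c<a
  where
  rank : ℕ → ℕ
  rank x = suc (length (filter (_<? x) (a ∷ b ∷ c ∷ [])))
  rank-3⇒ : rank a ≡ 3 → c < a
  rank-3⇒ r rewrite ≤⇒<ᵇ≡ (≤-refl {a}) with b <ᵇ a
  rank-3⇒ r | true  with c <ᵇ a in c<ᵇa
  rank-3⇒ r | true  | true  = <ᵇ⇒< c a (≡true⇒T c<ᵇa)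
  rank-3⇒ () | true  | false
  rank-3⇒ r | false with c <ᵇ a
  rank-3⇒ () | false | true
  rank-3⇒ () | false | false
  c<a : c < a
  c<a = rank-3⇒ (∷-injectiveˡ e)
  b<c : rank c ≡ 2 → b < c
  b<c r rewrite ≤⇒<ᵇ≡ (<⇒≤ c<a) with b <ᵇ c in b<ᵇc
  b<c r | true  = <ᵇ⇒< b c (≡true⇒T b<ᵇc)
  b<c r | false rewrite ≤⇒<ᵇ≡ (≤-refl {c}) with () ← r

no312⇒avoids : ∀ {π} → No312 π → Avoids π p312
no312⇒avoids no312 (a ∷ b ∷ c ∷ [] , q , e) with standardize⁻-312 a b c e
... | b<c , c<a = no312 q b<c c<a
no312⇒avoids no312 (_ ∷ _ ∷ _ ∷ _ ∷ _ , q , e) with () ← cong length e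

-- An entry above `c` standing before `b` would form 312 with `b` and `c`; distinctness rules out
-- ties.
no312⇒dominate : ∀ {π} → Unique π → No312 π → AscentTopsDominate π
no312⇒dominate un no312 u b c q b≤c = All.∷ʳ⁺ (All.tabulate below) b<c
  where
  b<c : b < c
  b<c = ≤∧≢⇒< b≤c (AllPairs-⊆ un (⊆-trans (++⁺ˡ u ⊆-refl) q))
  below : ∀ {a} → a ∈ u → a < c
  below i = ≰⇒> λ c≤a → no312 abc b<c (≤∧≢⇒< c≤a λ e → AllPairs-⊆ un (⊆-trans (refl ∷ b ∷ʳ ⊆-refl) abc) (sym e))
    where abc = ⊆-trans (++⁺ (from∈ i) ⊆-refl) q

-- The two words as descents of a permutation and of its inverse

applyUpTo-isDesc : ∀ (g : Bool → Step) l m → length l ≡ suc m →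
  applyUpTo (λ i → g (isDesc l (suc i))) m ≡ steps (λ a b → g (b <ᵇ a)) l
applyUpTo-isDesc g (a ∷ [])    zero    e = refl
applyUpTo-isDesc g (a ∷ b ∷ l) (suc m) e =
  cong (g (b <ᵇ a) ∷_) (applyUpTo-isDesc g (b ∷ l) m (suc-injective e))

map-range1 : ∀ (f : ℕ → Step) m → map f (range1 m) ≡ applyUpTo (λ i → f (suc i)) m
map-range1 f m = trans (sym (map-∘ (upTo m))) (map-upTo (λ i → f (suc i)) m)

applyDownFrom-∸ : ∀ (f : ℕ → Step) m →
  applyUpTo (λ i → f (m ∸ i)) m ≡ applyDownFrom (λ i → f (suc i)) m
applyDownFrom-∸ f zero    = refl
applyDownFrom-∸ f (suc m) = cong (f (suc m) ∷_) (applyDownFrom-∸ f m)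

DL-descents : ∀ π m → length π ≡ suc m →
  map (λ i → if isDesc π (suc m ∸ i) then D else U) (range1 m) ≡ descentPath π
DL-descents π m l = begin
  map (λ i → letter (suc m ∸ i)) (range1 m)      ≡⟨ map-range1 (λ i → letter (suc m ∸ i)) m ⟩
  -- The index in place `i` is `suc i`, and `suc m ∸ suc i` is `m ∸ i`: the letters belong to the
  -- positions `m` down to 1.
  applyUpTo (λ i → letter (m ∸ i)) m             ≡⟨ applyDownFrom-∸ letter m ⟩
  applyDownFrom (λ i → letter (suc i)) m         ≡⟨ reverse-applyUpTo (λ i → letter (suc i)) m ⟨
  reverse (applyUpTo (λ i → letter (suc i)) m)   ≡⟨ cong reverse (applyUpTo-isDesc (λ b → if b then D else U) π m l) ⟩
  reverse (steps desc π)                         ∎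
  where
  open ≡-Reasoning
  letter : ℕ → Step
  letter i = if isDesc π i then D else U

steps-reverse : ∀ f l → steps f (reverse l) ≡ reverse (steps (λ a b → f b a) l)
steps-reverse f []          = refl
steps-reverse f (a ∷ [])    = refl
steps-reverse f (a ∷ b ∷ l) = begin
  steps f (reverse (a ∷ b ∷ l))                ≡⟨ cong (steps f) (unfold-reverse a (b ∷ l)) ⟩
  steps f (reverse (b ∷ l) ++ [ a ])           ≡⟨ cong (λ w → steps f (w ++ [ a ])) (unfold-reverse b l) ⟩
  steps f ((reverse l ++ [ b ]) ++ [ a ])      ≡⟨ steps-∷ʳ f (reverse l) b a ⟩
  steps f (reverse l ++ [ b ]) ++ [ f b a ]    ≡⟨ cong (λ w → steps f w ++ [ f b a ]) (unfold-reverse b l) ⟨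
  steps f (reverse (b ∷ l)) ++ [ f b a ]       ≡⟨ cong (_++ [ f b a ]) (steps-reverse f (b ∷ l)) ⟩
  reverse (steps f′ (b ∷ l)) ++ [ f b a ]      ≡⟨ unfold-reverse (f b a) (steps f′ (b ∷ l)) ⟨
  reverse (steps f′ (a ∷ b ∷ l))               ∎
  where
  open ≡-Reasoning
  f′ = λ a b → f b a

steps-map : ∀ f g l → steps f (map g l) ≡ steps (λ a b → f (g a) (g b)) l
steps-map f g []          = refl
steps-map f g (a ∷ [])    = refl
steps-map f g (a ∷ b ∷ l) = cong (_ ∷_) (steps-map f g (b ∷ l))

position-here : ∀ x xs → position x (x ∷ xs) ≡ 1
position-here x xs with x ≡ᵇ x in e
... | true  = refl
... | false = contradiction (≡⇒≡ᵇ x x refl) (≡false⇒¬T e)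

position-there : ∀ {x j} xs → x ≢ j → position j (x ∷ xs) ≡ suc (position j xs)
position-there {x} {j} xs ne with x ≡ᵇ j in e
... | true  = contradiction (≡ᵇ⇒≡ x j (≡true⇒T e)) ne
... | false = refl

position-positive : ∀ {j xs} → j ∈ xs → 0 < position j xs
position-positive {j} {x ∷ xs} i with x ≡ᵇ j
... | true  = z<s
... | false = z<s

position-< : ∀ {i j π} → Unique π → (i ∷ j ∷ []) ⊆ π → position i π < position j π
position-< {i} {j} (x∉ ∷ un) (_∷ʳ_ {ys = ys} x p)
  rewrite position-there ys (All.lookup x∉ (∈-⊆ p (here refl)))
        | position-there ys (All.lookup x∉ (∈-⊆ p (there (here refl)))) = s<s (position-< un p)
position-< {i} {j} (x∉ ∷ un) (_∷_ {ys = ys} refl p)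
  rewrite position-here i ys | position-there ys (All.lookup x∉ (to∈ p)) = s<s (position-positive (to∈ p))

asc : ℕ → ℕ → Step
asc a b = if a <ᵇ b then U else D

inverseDescents-steps : ∀ {π v α} → Unique π → InverseDescents π v α →
  steps (λ i j → asc (position i π) (position j π)) (iterate suc v (suc (length α))) ≡ α
inverseDescents-steps un []       = refl
inverseDescents-steps un (p ∷ᵁ q) =
  cong₂ _∷_ (cong (λ b → if b then U else D) (<⇒<ᵇ≡ (position-< un p))) (inverseDescents-steps un q)
inverseDescents-steps un (p ∷ᴰ q) =
  cong₂ _∷_ (cong (λ b → if b then U else D) (≤⇒<ᵇ≡ (<⇒≤ (position-< un p)))) (inverseDescents-steps un q)

-- As `rot π` is the reversed inverse, its descents are the ascents of the inverse read backwards; a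
-- U marks a value standing to the left of its successor.
DL-inverseDescents : ∀ {π m α} → IsPerm (suc m) π → length α ≡ m → InverseDescents π 1 α →
  map (λ i → if isDesc (rot π) i then U else D) (range1 m) ≡ reverse α
DL-inverseDescents {π} {m} {α} perm refl inv = begin
  map letter (range1 m)                                 ≡⟨ map-range1 letter m ⟩
  applyUpTo (λ i → letter (suc i)) m                    ≡⟨ applyUpTo-isDesc (λ b → if b then U else D) (rot π) m rot-length ⟩
  steps (λ a b → asc b a) (reverse (inverse π))         ≡⟨ steps-reverse (λ a b → asc b a) (inverse π) ⟩
  reverse (steps asc (map pos (range1 (length π))))     ≡⟨ cong reverse (steps-map asc pos (range1 (length π))) ⟩
  reverse (steps pos-asc (range1 (length π)))           ≡⟨ cong (λ n → reverse (steps pos-asc (range1 n))) (perm-length perm) ⟩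
  reverse (steps pos-asc (range1 (suc m)))              ≡⟨ cong (λ l → reverse (steps pos-asc l)) (range1-iterate (suc m)) ⟩
  reverse (steps pos-asc (iterate suc 1 (suc m)))       ≡⟨ cong reverse (inverseDescents-steps (perm-unique perm) inv) ⟩
  reverse α                                             ∎
  where
  open ≡-Reasoning
  letter : ℕ → Step
  letter i = if isDesc (rot π) i then U else D
  pos : ℕ → ℕ
  pos j = position j π
  pos-asc : ℕ → ℕ → Step
  pos-asc i j = asc (pos i) (pos j)
  rot-length : length (rot π) ≡ suc m
  rot-length = begin
    length (rot π)               ≡⟨ length-reverse (inverse π) ⟩
    length (inverse π)           ≡⟨ length-map pos (range1 (length π)) ⟩
    length (range1 (length π))   ≡⟨ length-range1 (length π) ⟩
    length π                     ≡⟨ perm-length perm ⟩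
    suc m                        ∎

-- This reduces the map to stack runs: it reads the letters of the run backwards.
DL-push : ∀ k {π α β} → IsPerm (suc (2 * k)) π → length α ≡ 2 * k → Push [] 1 α β π →
  DL k π ≡ (reverse β , reverse α)
DL-push k {π} perm l p = cong₂ _,_
  (trans (DL-descents π (2 * k) (perm-length perm)) (cong reverse (push-steps ([] ∷ []) p)))
  (DL-inverseDescents perm l (push-inverseDescents p))

-- Unique sortedness and Dyck paths

dyck⇒uniquelySorted : ∀ {n π} → IsPerm n π → AscentTopsDominate π →
  Path 0 (descentPath π) 0 → UniquelySorted n π
dyck⇒uniquelySorted {π = π} perm dom d with σ , p ← preimage _ π ≤-refl dom d =
  σ , (↭-trans (↝⇒↭ p) perm , ↝⇒stackSort p) ,
  λ τ _ e → dyck-preimage-unique (subst (τ ↝_) e (stackSort-↝ τ)) p refl d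

uniquelySorted⇒dyck : ∀ {n π} → IsPerm n π → AscentTopsDominate π →
  UniquelySorted n π → Path 0 (descentPath π) 0
uniquelySorted⇒dyck {π = π} perm dom (σ , (_ , e) , unique)
  with sorted-path (subst (σ ↝_) e (stackSort-↝ σ))
... | zero  , d = d
... | suc j , d with τ , ρ , p , q , τ≢ρ ← two-preimages _ π ≤-refl dom d =
  contradiction (trans (only p) (sym (only q))) τ≢ρ
  where
  only : ∀ {τ} → τ ↝ π → τ ≡ σ
  only p = unique _ (↭-trans (↝⇒↭ p) perm) (↝⇒stackSort p)

-- Reversal and dominance of words

countU-++ : ∀ u v → countU (u ++ v) ≡ countU u + countU v
countU-++ []      v = refl
countU-++ (U ∷ u) v = cong suc (countU-++ u v)
countU-++ (D ∷ u) v = countU-++ u v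

countU-reverse : ∀ w → countU (reverse w) ≡ countU w
countU-reverse [] = refl
countU-reverse (x ∷ w) = begin
  countU (reverse (x ∷ w))           ≡⟨ cong countU (unfold-reverse x w) ⟩
  countU (reverse w ++ [ x ])        ≡⟨ countU-++ (reverse w) [ x ] ⟩
  countU (reverse w) + countU [ x ]  ≡⟨ +-comm _ (countU [ x ]) ⟩
  countU [ x ] + countU (reverse w)  ≡⟨ cong (countU [ x ] +_) (countU-reverse w) ⟩
  countU [ x ] + countU w            ≡⟨ countU-++ [ x ] w ⟨
  countU (x ∷ w)                     ∎
  where open ≡-Reasoning

countU+countD : ∀ w → countU w + countD w ≡ length w
countU+countD []      = refl
countU+countD (U ∷ w) = cong suc (countU+countD w)
countU+countD (D ∷ w) = trans (+-suc (countU w) _) (cong suc (countU+countD w))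

take-++-length : ∀ (u v : List Step) → take (length u) (u ++ v) ≡ u
take-++-length []      v = refl
take-++-length (x ∷ u) v = cong (x ∷_) (take-++-length u v)

take-reverse : ∀ i (w : List Step) → i ≤ length w →
  take i (reverse w) ≡ reverse (drop (length w ∸ i) w)
take-reverse i w i≤ = begin
  take i (reverse w)                     ≡⟨ cong (λ w → take i (reverse w)) (take++drop≡id m w) ⟨
  take i (reverse (take m w ++ drop m w)) ≡⟨ cong (take i) (reverse-++ (take m w) (drop m w)) ⟩
  take i (r ++ reverse (take m w))       ≡⟨ cong (λ i → take i (r ++ reverse (take m w))) len ⟨
  take (length r) (r ++ reverse (take m w)) ≡⟨ take-++-length r _ ⟩
  r                                      ∎
  where
  open ≡-Reasoning
  m = length w ∸ i
  r = reverse (drop m w)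
  len : length r ≡ i
  len = trans (length-reverse (drop m w)) (trans (length-drop m w) (m∸[m∸n]≡n i≤))

infix 4 _≼_

_≼_ : List Step → List Step → Set
u ≼ v = ∀ i → countU (take i u) ≤ countU (take i v)

-- A prefix of the reversal is a reversed suffix. The totals being equal, comparing suffixes is
-- comparing the complementary prefixes the other way round.
reverse-≼ : ∀ u v → length u ≡ length v → countU u ≡ countU v → u ≼ v → reverse v ≼ reverse u
reverse-≼ u v l c u≼v i with ≤-total i (length v)
... | inj₂ i≥ = ≤-reflexive (begin
    countU (take i (reverse v))  ≡⟨ cong countU (take-all i _ (≤-trans (≤-reflexive (length-reverse v)) i≥)) ⟩
    countU (reverse v)           ≡⟨ countU-reverse v ⟩
    countU v                     ≡⟨ c ⟨
    countU u                     ≡⟨ countU-reverse u ⟨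
    countU (reverse u)           ≡⟨ cong countU (take-all i _ (≤-trans (≤-reflexive (trans (length-reverse u) l)) i≥)) ⟨
    countU (take i (reverse u))  ∎)
  where open ≡-Reasoning
... | inj₁ i≤ = begin
    countU (take i (reverse v))           ≡⟨ cong countU (take-reverse i v i≤) ⟩
    countU (reverse (drop (length v ∸ i) v))  ≡⟨ countU-reverse (drop (length v ∸ i) v) ⟩
    countU (drop (length v ∸ i) v)            ≤⟨ drop-≤ (length v ∸ i) ⟩
    countU (drop (length v ∸ i) u)            ≡⟨ cong (λ n → countU (drop (n ∸ i) u)) l ⟨
    countU (drop (length u ∸ i) u)            ≡⟨ countU-reverse (drop (length u ∸ i) u) ⟨
    countU (reverse (drop (length u ∸ i) u))  ≡⟨ cong countU (take-reverse i u (subst (i ≤_) (sym l) i≤)) ⟨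
    countU (take i (reverse u))           ∎
  where
  open ≤-Reasoning
  take+drop : ∀ m w → countU (take m w) + countU (drop m w) ≡ countU w
  take+drop m w = trans (sym (countU-++ (take m w) _)) (cong countU (take++drop≡id m w))
  drop-≤ : ∀ m → countU (drop m v) ≤ countU (drop m u)
  drop-≤ m = +-cancelˡ-≤ (countU (take m u)) _ _ (begin
    countU (take m u) + countU (drop m v)  ≤⟨ +-monoˡ-≤ _ (u≼v m) ⟩
    countU (take m v) + countU (drop m v)  ≡⟨ take+drop m v ⟩
    countU v                               ≡⟨ c ⟨
    countU u                               ≡⟨ take+drop m u ⟨
    countU (take m u) + countU (drop m u)  ∎)

half : ∀ {a b} k → a ≡ b → a + b ≡ 2 * k → a ≡ k
half {a} k refl e = *-cancelˡ-≡ a k 2 (trans (cong (a +_) (+-identityʳ a)) e)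

path⇒isDyck : ∀ k {w} → length w ≡ 2 * k → Path 0 w 0 → IsDyck k w
path⇒isDyck k {w} l p = u≡k , trans (sym u≡d) u≡k , path-prefix p
  where
  u≡d = path-counts p
  u≡k = half k u≡d (trans (countU+countD w) l)

isDyck⇒path : ∀ {k w} → IsDyck k w → Path 0 w 0
isDyck⇒path (u , d , h) = prefix-path 0 0 _ (trans u (sym d)) h

isDyck-length : ∀ {k w} → IsDyck k w → length w ≡ 2 * k
isDyck-length {k} {w} (u , d , _) =
  trans (sym (countU+countD w)) (cong₂ _+_ u (trans d (sym (+-identityʳ k))))

-- More U's in every prefix mean fewer D's, so only the smaller word has to be shown Dyck; the
-- larger one inherits it.
isDyck-≼ : ∀ {k u v} → length u ≡ length v → countU u ≡ countU v → u ≼ v →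
  IsDyck k u → IsDyck k v
isDyck-≼ {k} {u} {v} l c u≼v (uk , dk , h) =
  trans (sym c) uk , trans (sym countD-eq) dk ,
  λ i → ≤-trans (countD-≤ i) (≤-trans (h i) (u≼v i))
  where
  countD-eq : countD u ≡ countD v
  countD-eq = +-cancelˡ-≡ (countU u) _ _ (begin
    countU u + countD u  ≡⟨ countU+countD u ⟩
    length u             ≡⟨ l ⟩
    length v             ≡⟨ countU+countD v ⟨
    countU v + countD v  ≡⟨ cong (_+ countD v) c ⟨
    countU u + countD v  ∎)
    where open ≡-Reasoning
  countD-≤ : ∀ i → countD (take i v) ≤ countD (take i u)
  countD-≤ i = +-cancelˡ-≤ (countU (take i v)) _ _ (begin
    countU (take i v) + countD (take i v)  ≡⟨ countU+countD (take i v) ⟩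
    length (take i v)                      ≡⟨ trans (length-take i v) (trans (cong (i ⊓_) (sym l)) (sym (length-take i u))) ⟩
    length (take i u)                      ≡⟨ countU+countD (take i u) ⟨
    countU (take i u) + countD (take i u)  ≤⟨ +-monoˡ-≤ _ (u≼v i) ⟩
    countU (take i v) + countD (take i u)  ∎)
    where
    open ≤-Reasoning

-- Beyond the length both prefixes are the whole words, where the equal totals take over.
≤S⇒≼ : ∀ {u v} → length u ≡ length v → countU u ≡ countU v → u ≤S v → u ≼ v
≤S⇒≼ l c h zero = z≤n
≤S⇒≼ {u} {v} l c h (suc i) with ≤-total (suc i) (length u)
... | inj₁ i≤ = h (suc i) (s≤s z≤n) i≤
... | inj₂ i≥ rewrite take-all (suc i) u i≥ | take-all (suc i) v (subst (_≤ suc i) l i≥) =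
  ≤-reflexive c

-- Assembling the bijection

InU312⇒push : ∀ {m π} → InU312 (suc m) π → ∃₂ λ α β → Push [] 1 α β π × length α ≡ m
InU312⇒push {m} {π} (perm , _ , av)
  with α , β , p ← push-complete m π (subst (π ↭_) (range1-iterate (suc m)) perm)
                     (perm-unique perm) (avoids⇒no312 av)
  = α , β , p , suc-injective (trans (sym (perm-length (push-perm p))) (perm-length perm))
  where
  push-perm : ∀ {α β π} → Push [] 1 α β π → IsPerm (suc (length α)) π
  push-perm {α} {π = π} p = subst (π ↭_) (sym (range1-iterate (suc (length α)))) (push-↭ p)

theorem5p4 : (k : ℕ) →
    ((π : List ℕ) → InU312 (suc (2 * k)) π → InInt k (DL k π))
    × ((π π′ : List ℕ) → InU312 (suc (2 * k)) π → InU312 (suc (2 * k)) π′ →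
    DL k π ≡ DL k π′ → π ≡ π′)
    × ((Λs : List Step × List Step) → InInt k Λs →
    Σ (List ℕ) λ π → InU312 (suc (2 * k)) π × DL k π ≡ Λs)
theorem5p4 k = into , injective , surjective
  where
  into : (π : List ℕ) → InU312 (suc (2 * k)) π → InInt k (DL k π)
  into π inU@(perm , sorted , av) with α , β , p , l ← InU312⇒push inU
    = subst (InInt k) (sym (DL-push k perm l p))
        (dyck , isDyck-≼ lengths counts dominance dyck , λ i _ _ → dominance i)
    where
    α-β : length α ≡ length β
    α-β = sym (push-length p)
    lengths : length (reverse β) ≡ length (reverse α)
    lengths = trans (length-reverse β) (trans (sym α-β) (sym (length-reverse α)))
    counts : countU (reverse β) ≡ countU (reverse α)
    counts = trans (countU-reverse β) (trans (sym (push-countU p)) (sym (countU-reverse α)))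
    dominance : reverse β ≼ reverse α
    dominance = reverse-≼ α β α-β (push-countU p) (push-dominance p)
    dyck : IsDyck k (reverse β)
    dyck = path⇒isDyck k (trans (length-reverse β) (trans (sym α-β) l))
      (subst (λ w → Path 0 (reverse w) 0) (push-steps ([] ∷ []) p)
        (uniquelySorted⇒dyck perm (no312⇒dominate (perm-unique perm) (avoids⇒no312 av)) sorted))

  injective : (π π′ : List ℕ) → InU312 (suc (2 * k)) π → InU312 (suc (2 * k)) π′ →
    DL k π ≡ DL k π′ → π ≡ π′
  injective π π′ inU inU′ e
    with α , β , p , l ← InU312⇒push inU | α′ , β′ , p′ , l′ ← InU312⇒push inU′
    with e′ ← trans (sym (DL-push k (proj₁ inU) l p)) (trans e (DL-push k (proj₁ inU′) l′ p′))
    with refl ← reverse-injective {x = β} {β′} (cong proj₁ e′)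
       | refl ← reverse-injective {x = α} {α′} (cong proj₂ e′)
    = push-functional p p′

  surjective : (Λs : List Step × List Step) → InInt k Λs →
    Σ (List ℕ) λ π → InU312 (suc (2 * k)) π × DL k π ≡ Λs
  surjective (Λ , Λ′) (dyck , dyck′ , Λ≤Λ′) =
    π , (perm , dyck⇒uniquelySorted perm (no312⇒dominate (perm-unique perm) no312) path ,
         no312⇒avoids no312) ,
    trans (DL-push k perm l p) (cong₂ _,_ (reverse-involutive Λ) (reverse-involutive Λ′))
    where
    -- The map reads runs backwards, so the run to be found has the reversed words.
    α = reverse Λ′
    β = reverse Λ
    l : length α ≡ 2 * k
    l = trans (length-reverse Λ′) (isDyck-length dyck′)
    lengths : length Λ ≡ length Λ′
    lengths = trans (isDyck-length dyck) (sym (isDyck-length dyck′))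
    counts : countU Λ ≡ countU Λ′
    counts = trans (proj₁ dyck) (sym (proj₁ dyck′))
    run : ∃ (Push [] 1 α β)
    run = push-exists [] 1 α β
      (trans (length-reverse Λ) (trans lengths (sym (length-reverse Λ′))))
      (trans (countU-reverse Λ′) (trans (sym counts) (sym (countU-reverse Λ))))
      (reverse-≼ Λ Λ′ lengths counts (≤S⇒≼ lengths counts Λ≤Λ′))
    π = proj₁ run
    p = proj₂ run
    no312 : No312 π
    no312 = push-no312 ([] ∷ []) p
    perm : IsPerm (suc (2 * k)) π
    perm = subst (π ↭_) (sym (range1-iterate (suc (2 * k))))
      (subst (λ m → π ↭ iterate suc 1 (suc m)) l (push-↭ p))
    path : Path 0 (descentPath π) 0
    path = subst (λ w → Path 0 w 0)
      (sym (trans (cong reverse (push-steps ([] ∷ []) p)) (reverse-involutive Λ))) (isDyck⇒path dyck)
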